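{- Let $\sigma$ be a permutation of length $k\ge 2$. If $\sigma(1)$ and $\sigma(2)$ are consecutive integers, then for every $n\ge k$ there exists a permutation $\pi$ of length $n$ such that $|s_{\{\sigma\}}^{ -1}(\pi)|=C_{n-k+2}$. If $\sigma(1)$ and $\sigma(2)$ are not consecutive integers, then for every $n>k$ there is no permutation $\pi$ of length $n$ with $|s_{\{\sigma\}}^{ -1}(\pi)|=C_{n-k+2}$. Here $C_m=\frac{1}{m+1}\binom{2m}{m}$ is the $m$th Catalan number and the preimage is taken in the set of permutations of length $n$.
   Context: A sequence of distinct integers contains a permutation $\tau$ if some subsequence is order-isomorphic to $\tau$; otherwise it avoids $\tau$. For a set $T$ of permutations (each of length at least 2), the map $s_T$ is defined by: read the input permutation left to right with an initially empty stack and output; at each step, if there is a next input element and pushing it keeps the stack contents, read from top to bottom, $T$-avoiding, push it; otherwise pop the top of the stack and append it to the output; stop when input and stack are empty; the output is $s_T(\pi)$. -}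

module Defs where

open import Data.Nat using (ℕ; zero; suc; _+_; _*_; _≡ᵇ_; _<ᵇ_; _/_)
open import Data.Nat.Combinatorics using (_C_)
open import Data.Bool using (Bool; true; false; _∧_; if_then_else_; T)
open import Data.List using (List; []; _∷_; map; _++_; length)
open import Data.Bool.ListAction using (any; all)
open import Data.Empty using (⊥)
open import Data.Sum using (_⊎_)
open import Data.Product using (Σ; _×_)
open import Relation.Binary.PropositionalEquality using (_≡_)

_==_ : Bool → Bool → Bool
true  == b = b
false == true = false
false == false = true

oneTo : ℕ → List ℕ
oneTo zero    = []
oneTo (suc n) = oneTo n ++ (suc n ∷ [])

-- a permutation of length n (one-line notation, values 1..n):
-- a word of length n in which every i ∈ {1,…,n} occurs
isPermᵇ : ℕ → List ℕ → Bool
isPermᵇ n l = (length l ≡ᵇ n) ∧ all (λ i → any (λ x → i ≡ᵇ x) l) (oneTo n)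

IsPerm : ℕ → List ℕ → Set
IsPerm n l = T (isPermᵇ n l)

subseqs : List ℕ → List (List ℕ)
subseqs []       = [] ∷ []
subseqs (x ∷ xs) = map (x ∷_) (subseqs xs) ++ subseqs xs

-- order-isomorphism of two sequences of distinct integers:
-- same length and for all positions i < j, (a_i < a_j) iff (b_i < b_j)
orderIsoᵇ : List ℕ → List ℕ → Bool
orderIsoᵇ []       []       = true
orderIsoᵇ (x ∷ xs) (y ∷ ys) = pairs xs ys ∧ orderIsoᵇ xs ys
  where
  pairs : List ℕ → List ℕ → Bool
  pairs []       []       = true
  pairs (u ∷ us) (v ∷ vs) = ((x <ᵇ u) == (y <ᵇ v)) ∧ pairs us vs
  pairs _        _        = false
orderIsoᵇ _        _        = false

containsᵇ : List ℕ → List ℕ → Bool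
containsᵇ τ w = any (λ u → orderIsoᵇ u τ) (subseqs w)

-- the stack-sorting map s_{σ} (T = {σ}); the stack is a list with its top first,
-- so the stack contents read top to bottom is the list itself.
-- run σ input stack : output
run : List ℕ → List ℕ → List ℕ → List ℕ
run σ []       []       = []
run σ []       (y ∷ ys) = y ∷ run σ [] ys
run σ (x ∷ xs) []       = run σ xs (x ∷ [])   -- push onto empty stack ({x} avoids σ as |σ| ≥ 2)
run σ (x ∷ xs) (y ∷ ys) =
  if containsᵇ σ (x ∷ y ∷ ys)
  then y ∷ run σ (x ∷ xs) ys
  else run σ xs (x ∷ y ∷ ys)

s : List ℕ → List ℕ → List ℕ
s σ π = run σ π []

Preimage : List ℕ → ℕ → List ℕ → Set
Preimage σ n π = Σ (List ℕ) (λ ρ → IsPerm n ρ × s σ ρ ≡ π)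

catalan : ℕ → ℕ
catalan m = ((2 * m) C m) / suc m

Consec : List ℕ → Set
Consec (a ∷ b ∷ _) = (a ≡ suc b) ⊎ (b ≡ suc a)
Consec _           = ⊥

{-# OPTIONS --safe #-}
module Submission where

-- An element is popped before the input is exhausted only if the next input element would complete
-- an occurrence of σ, so the stack then holds at least k - 1 elements. Hence the first k - 2 input
-- elements stay at the bottom of the stack until the end, and a run is encoded by a Dyck path of
-- semilength m = n - k + 2. The path and the output determine the input, so a permutation π has
-- at most C_m preimages, with equality iff every path comes from a preimage of π.
--
-- If σ(1), σ(2) are consecutive, let π start with a monotone interval of m values, ordered
-- oppositely to σ(1), σ(2), and continue with σ(3) … σ(k) inflated around that interval; then every
-- pop is forced and every push is allowed. Otherwise, a path starting with UDUDU makes some element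
-- play the roles of both σ(1) and σ(2) above the same bottom B ≅ σ(3) … σ(k), although an entry of B
-- separates these roles.

open import Defs
open import Data.Bool using (true; false; T; if_then_else_)
open import Data.Bool.Properties using (T-≡; T-∧; T-irrelevant)
open import Data.Fin using (Fin; zero)
open import Data.Fin.Properties using (+↔⊎; punchOut-injective; <⇒notInjective)
open import Data.List using (List; []; _∷_; _++_; length; map; reverse; _ʳ++_; applyUpTo; applyDownFrom)
open import Data.List.Properties using (length-++; ∷-injective; length-reverse; length-map; reverse-injective; reverse-involutive; ++-identityʳ; length-applyUpTo; length-applyDownFrom)
open import Data.List.Membership.Propositional using (_∈_; find; lose)
open import Data.List.Membership.Propositional.Properties using (∈-++⁺ˡ; ∈-++⁺ʳ; ∈-++⁻; ∈-map⁺; ∈-map⁻; ∈-∃++; ∈-applyUpTo⁺; ∈-applyDownFrom⁺)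
open import Data.List.Relation.Binary.Permutation.Propositional using (_↭_; ↭-refl; ↭-sym; ↭-trans; prep; ↭-reflexive; ↭⇒↭ₛ)
open import Data.List.Relation.Binary.Permutation.Propositional.Properties using (∈-resp-↭; shift; ↭-length)
open import Data.List.Relation.Binary.Permutation.Setoid.Properties using (Unique-resp-↭)
open import Data.List.Relation.Binary.Pointwise using (Pointwise; []; _∷_)
open import Data.List.Relation.Binary.Sublist.Propositional using (_⊆_; []; _∷_; _∷ʳ_; ⊆-refl; ⊆-trans; lookup)
open import Data.List.Relation.Binary.Sublist.Propositional.Properties using (length-mono-≤; ++⁺ˡ; All-resp-⊆)
open import Data.List.Relation.Unary.All as All using (All; []; _∷_)
open import Data.List.Relation.Unary.All.Properties using (all⁺; all⁻)
open import Data.List.Relation.Unary.AllPairs using (AllPairs; []; _∷_)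
open import Data.List.Relation.Unary.AllPairs.Properties using (applyUpTo⁺₁; applyDownFrom⁺₁)
open import Data.List.Relation.Unary.Any as Any using (here; there)
open import Data.List.Relation.Unary.Any.Properties using (any⁺; any⁻)
open import Data.List.Relation.Unary.Unique.Propositional using (Unique)
open import Data.List.Relation.Unary.Unique.Propositional.Properties as Uniq using ()
open import Data.Nat
open import Data.Nat.Combinatorics using (_C_; nCk≡nC[n∸k]; nCk+nC[k+1]≡[n+1]C[k+1])
open import Data.Nat.DivMod using (m*n/n≡m)
open import Data.Nat.Properties
open import Data.Nat.Tactic.RingSolver using (solve-∀)
open import Data.Product using (Σ; ∃; _×_; _,_; proj₁; proj₂)
open import Data.Sum using (inj₁; inj₂)
open import Data.Sum.Function.Propositional using (_⊎-↔_)
open import Data.Vec as Vec using (Vec; []; _∷_; toList; fromList)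
open import Data.Vec.Properties as Vec using (toList-++; toList-cast; toList-injective; toList∘fromList; length-toList)
open import Function using (_∘_)
open import Function.Bundles using (_↔_; mk⤖; mk↔ₛ′; module Inverse; module Injection; module Equivalence)
open import Function.Construct.Composition using (_↔-∘_)
open import Function.Construct.Symmetry using (↔-sym)
open import Function.Definitions using (Injective)
open import Function.Properties.Bijection using (⤖⇒↔)
open import Function.Properties.Inverse using (↔⇒↣)
open import Relation.Binary.Definitions using (tri<; tri≈; tri>)
open import Relation.Binary.PropositionalEquality
open import Relation.Nullary using (¬_; yes; no; contradiction)
open Equivalence using (to; from)

-- Counting lattice paths: ballot and Catalan numbers.

-- Lattice paths from height h with u up-steps left; the descent after the last up-step is left implicit.
data Path : ℕ → ℕ → Set where
  end  : ∀ {h} → Path h 0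
  up   : ∀ {h u} → Path (suc h) u → Path h (suc u)
  down : ∀ {h u} → Path h (suc u) → Path (suc h) (suc u)

up-injective : ∀ {h u} {p q : Path (suc h) u} → up p ≡ up q → p ≡ q
up-injective refl = refl

down-injective : ∀ {h u} {p q : Path h (suc u)} → down p ≡ down q → p ≡ q
down-injective refl = refl

-- The ballot numbers; at height 0 they are the Catalan numbers.
#paths : ℕ → ℕ → ℕ
#paths h       zero    = 1
#paths zero    (suc u) = #paths 1 u
#paths (suc h) (suc u) = #paths (2 + h) u + #paths h (suc u)

Fin#paths↔Path : ∀ h u → Fin (#paths h u) ↔ Path h u
Fin#paths↔Path h zero = mk↔ₛ′ (λ _ → end) (λ _ → zero) (λ { end → refl }) (λ { zero → refl })
Fin#paths↔Path zero (suc u) =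
  mk↔ₛ′ up (λ { (up p) → p }) (λ { (up p) → refl }) (λ p → refl) ↔-∘ Fin#paths↔Path 1 u
Fin#paths↔Path (suc h) (suc u) =
  mk↔ₛ′ (λ { (inj₁ p) → up p ; (inj₂ p) → down p })
        (λ { (up p) → inj₁ p ; (down p) → inj₂ p })
        (λ { (up p) → refl ; (down p) → refl })
        (λ { (inj₁ p) → refl ; (inj₂ p) → refl })
  ↔-∘ ((Fin#paths↔Path (2 + h) u ⊎-↔ Fin#paths↔Path h (suc u)) ↔-∘ +↔⊎)

-- The binomial with lower index k - 1. The value 0 at k = 0 lets the reflection formula hold
-- without a side condition.
_C⁻_ : ℕ → ℕ → ℕ
n C⁻ zero  = 0
n C⁻ suc k = n C k

pascal⁻ : ∀ n k → n C⁻ k + n C k ≡ suc n C k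
pascal⁻ n zero    = refl
pascal⁻ n (suc k) = nCk+nC[k+1]≡[n+1]C[k+1] n k

-- For the height-0 case of the reflection formula: after Pascal's rule, the two summands of the
-- central binomial coincide.
central-symmetry : ∀ u → suc (u + u) C suc u ≡ suc (u + u) C u
central-symmetry u = trans (nCk≡nC[n∸k] (s≤s (m≤m+n u u))) (cong (suc (u + u) C_) (m+n∸m≡n u u))

-- The reflection principle.
#paths+C⁻≡C : ∀ h u → #paths h u + (u + u + h) C⁻ u ≡ (u + u + h) C u
#paths+C⁻≡C h zero = refl
#paths+C⁻≡C zero (suc u)
  rewrite +-identityʳ (u + suc u) | +-suc u u
        | sym (nCk+nC[k+1]≡[n+1]C[k+1] (suc (u + u)) u)
        | sym (pascal⁻ (suc (u + u)) u)
        | central-symmetry u = begin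
  #paths 1 u + (suc (u + u) C⁻ u + suc (u + u) C u)
    ≡⟨ +-assoc (#paths 1 u) _ _ ⟨
  #paths 1 u + suc (u + u) C⁻ u + suc (u + u) C u
    ≡⟨ cong (_+ suc (u + u) C u) (subst (λ n → #paths 1 u + n C⁻ u ≡ n C u) (+-comm (u + u) 1) (#paths+C⁻≡C 1 u)) ⟩
  suc (u + u) C u + suc (u + u) C u ∎
  where open ≡-Reasoning
#paths+C⁻≡C (suc h) (suc u) = begin
  #paths (2 + h) u + #paths h (suc u) + (suc u + suc u + suc h) C u
    ≡⟨ cong (λ n → #paths (2 + h) u + #paths h (suc u) + n C u) (lem₁ u h) ⟩
  #paths (2 + h) u + #paths h (suc u) + suc N C u
    ≡⟨ cong (#paths (2 + h) u + #paths h (suc u) +_) (pascal⁻ N u) ⟨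
  #paths (2 + h) u + #paths h (suc u) + (N C⁻ u + N C u)
    ≡⟨ lem₂ (#paths (2 + h) u) _ _ _ ⟩
  (#paths (2 + h) u + N C⁻ u) + (#paths h (suc u) + N C u)
    ≡⟨ cong₂ _+_ (subst (λ n → #paths (2 + h) u + n C⁻ u ≡ n C u) (lem₃ u h) (#paths+C⁻≡C (2 + h) u))
                 (#paths+C⁻≡C h (suc u)) ⟩
  N C u + N C suc u
    ≡⟨ nCk+nC[k+1]≡[n+1]C[k+1] N u ⟩
  suc N C suc u
    ≡⟨ cong (_C suc u) (lem₁ u h) ⟨
  (suc u + suc u + suc h) C suc u ∎
  where
  open ≡-Reasoning
  N = suc u + suc u + h
  lem₁ : ∀ u h → suc u + suc u + suc h ≡ suc (suc u + suc u + h)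
  lem₁ = solve-∀
  lem₂ : ∀ a b c d → a + b + (c + d) ≡ (a + c) + (b + d)
  lem₂ = solve-∀
  lem₃ : ∀ u h → u + u + (2 + h) ≡ suc u + suc u + h
  lem₃ = solve-∀

-- Induction through Pascal's rule, which avoids factorials and division.
absorption : ∀ n k → suc k * (suc n C suc k) ≡ suc n * (n C k)
absorption zero    zero    = refl
absorption zero    (suc k) = *-zeroʳ (2 + k)
absorption (suc n) zero    = begin
  1 * (suc (suc n) C 1)     ≡⟨ *-identityˡ _ ⟩
  suc (suc n) C 1           ≡⟨ nCk+nC[k+1]≡[n+1]C[k+1] (suc n) 0 ⟨
  1 + suc n C 1             ≡⟨ cong suc (trans (sym (*-identityˡ _)) (absorption n 0)) ⟩
  suc (suc n * 1)           ≡⟨⟩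
  suc (suc n) * 1 ∎
  where open ≡-Reasoning
absorption (suc n) (suc k) = begin
  suc (suc k) * (suc (suc n) C suc (suc k))
    ≡⟨ cong (suc (suc k) *_) (nCk+nC[k+1]≡[n+1]C[k+1] (suc n) (suc k)) ⟨
  suc (suc k) * (suc n C suc k + suc n C suc (suc k))
    ≡⟨ lem₁ k (suc n C suc k) _ ⟩
  suc n C suc k + (suc k * (suc n C suc k) + suc (suc k) * (suc n C suc (suc k)))
    ≡⟨ cong (suc n C suc k +_) (cong₂ _+_ (absorption n k) (absorption n (suc k))) ⟩
  suc n C suc k + (suc n * (n C k) + suc n * (n C suc k))
    ≡⟨ cong (suc n C suc k +_) (*-distribˡ-+ (suc n) (n C k) _) ⟨
  suc n C suc k + suc n * (n C k + n C suc k)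
    ≡⟨ cong (λ z → suc n C suc k + suc n * z) (nCk+nC[k+1]≡[n+1]C[k+1] n k) ⟩
  suc (suc n) * (suc n C suc k) ∎
  where
  open ≡-Reasoning
  lem₁ : ∀ k a b → suc (suc k) * (a + b) ≡ a + (suc k * a + suc (suc k) * b)
  lem₁ = solve-∀

-- Adding `suc u * (N C u)` to both sides makes each equal to `suc u * (suc N C suc u)`: the left by
-- absorption, the right by Pascal's rule.
suc-m*C⁻≡m*C : ∀ m → suc m * ((m + m) C⁻ m) ≡ m * ((m + m) C m)
suc-m*C⁻≡m*C zero    = refl
suc-m*C⁻≡m*C (suc u) = +-cancelʳ-≡ (suc u * (N C u)) _ _ (begin
  suc (suc u) * (N C u) + suc u * (N C u)   ≡⟨ lem₁ u (N C u) ⟩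
  suc N * (N C u)                           ≡⟨ absorption N u ⟨
  suc u * (suc N C suc u)                   ≡⟨ cong (suc u *_) (nCk+nC[k+1]≡[n+1]C[k+1] N u) ⟨
  suc u * (N C u + N C suc u)               ≡⟨ lem₂ u (N C u) _ ⟩
  suc u * (N C suc u) + suc u * (N C u)     ∎)
  where
  open ≡-Reasoning
  N = suc u + suc u
  lem₁ : ∀ u a → suc (suc u) * a + suc u * a ≡ suc (suc u + suc u) * a
  lem₁ = solve-∀
  lem₂ : ∀ u a b → suc u * (a + b) ≡ suc u * b + suc u * a
  lem₂ = solve-∀

-- The reflection formula at height 0, multiplied by m + 1; the ratio of the two binomials then
-- eliminates `c⁻`.
#paths*suc≡C : ∀ m → #paths 0 m * suc m ≡ (2 * m) C m
#paths*suc≡C m = subst (λ n → #paths 0 m * suc m ≡ n C m) (lem₁ m)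
  (+-cancelʳ-≡ (m * c) _ _ (begin
    p * suc m + m * c        ≡⟨ cong (p * suc m +_) (suc-m*C⁻≡m*C m) ⟨
    p * suc m + suc m * c⁻   ≡⟨ lem₂ m p c⁻ ⟩
    suc m * (p + c⁻)         ≡⟨ cong (suc m *_) (subst (λ n → p + n C⁻ m ≡ n C m) (+-identityʳ (m + m)) (#paths+C⁻≡C 0 m)) ⟩
    suc m * c                ∎))
  where
  open ≡-Reasoning
  p = #paths 0 m
  c = (m + m) C m
  c⁻ = (m + m) C⁻ m
  lem₁ : ∀ m → m + m ≡ 2 * m
  lem₁ = solve-∀
  lem₂ : ∀ m p c → p * suc m + suc m * c ≡ suc m * (p + c)
  lem₂ = solve-∀

catalan≡#paths : ∀ m → catalan m ≡ #paths 0 m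
catalan≡#paths m = trans (cong (_/ suc m) (sym (#paths*suc≡C m))) (m*n/n≡m (#paths 0 m) (suc m))

-- Permutations

∈-oneTo⁺ : ∀ {i n} → 1 ≤ i → i ≤ n → i ∈ oneTo n
∈-oneTo⁺ {n = zero}  (s≤s _) ()
∈-oneTo⁺ {n = suc n} 1≤i i≤1+n with m≤n⇒m<n∨m≡n i≤1+n
... | inj₁ i<1+n = ∈-++⁺ˡ (∈-oneTo⁺ 1≤i (≤-pred i<1+n))
... | inj₂ refl  = ∈-++⁺ʳ (oneTo n) (here refl)

∈-oneTo⁻ : ∀ {i} n → i ∈ oneTo n → 1 ≤ i × i ≤ n
∈-oneTo⁻ (suc n) i∈ with ∈-++⁻ (oneTo n) i∈
... | inj₁ i∈′         = proj₁ (∈-oneTo⁻ n i∈′) , m≤n⇒m≤1+n (proj₂ (∈-oneTo⁻ n i∈′))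
... | inj₂ (here refl) = s≤s z≤n , ≤-refl

length-oneTo : ∀ n → length (oneTo n) ≡ n
length-oneTo zero    = refl
length-oneTo (suc n) = trans (length-++ (oneTo n)) (trans (+-comm _ 1) (cong suc (length-oneTo n)))

oneTo-unique : ∀ n → Unique (oneTo n)
oneTo-unique zero    = []
oneTo-unique (suc n) = Uniq.++⁺ (oneTo-unique n) ([] ∷ [])
  λ { (1+n∈ , here refl) → <-irrefl refl (proj₂ (∈-oneTo⁻ n 1+n∈)) }

record Permutation (n : ℕ) (l : List ℕ) : Set where
  constructor mkPerm
  field
    length≡ : length l ≡ n
    covers  : ∀ {i} → 1 ≤ i → i ≤ n → i ∈ l
open Permutation

IsPerm⁻ : ∀ n l → IsPerm n l → Permutation n l
IsPerm⁻ n l p with len , cover ← to T-∧ p = mkPerm (≡ᵇ⇒≡ _ _ len)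
  λ 1≤i i≤n → Any.map (≡ᵇ⇒≡ _ _) (any⁻ _ l (All.lookup (all⁺ _ _ cover) (∈-oneTo⁺ 1≤i i≤n)))

IsPerm⁺ : ∀ {n l} → Permutation n l → IsPerm n l
IsPerm⁺ {n} (mkPerm len cover) = from T-∧
  (≡⇒≡ᵇ _ _ len ,
   all⁻ _ (All.tabulate λ i∈ → any⁺ _ (Any.map (≡⇒≡ᵇ _ _)
     (cover (proj₁ (∈-oneTo⁻ n i∈)) (proj₂ (∈-oneTo⁻ n i∈))))))

Permutation-resp-↭ : ∀ {n l l′} → l ↭ l′ → Permutation n l → Permutation n l′
Permutation-resp-↭ l↭l′ (mkPerm len cover) =
  mkPerm (trans (sym (↭-length l↭l′)) len) (λ 1≤i i≤n → ∈-resp-↭ l↭l′ (cover 1≤i i≤n))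

-- Induction on `U`: deleting one copy of its head from `l` still leaves the tail covered, as `U`
-- has no repetitions, and equal lengths leave nothing over at the end. Thus length and covering
-- alone force the entries of a permutation to be distinct.
covering⇒↭ : ∀ {U l : List ℕ} → Unique U → (∀ {i} → i ∈ U → i ∈ l) →
             length l ≡ length U → l ↭ U
covering⇒↭ {[]} {[]} _ _ _ = ↭-refl
covering⇒↭ {x ∷ U} {l} (x∉U ∷ uniq) cover len with ∈-∃++ (cover (here refl))
... | l₁ , l₂ , refl = ↭-trans l↭ (prep x (covering⇒↭ uniq cover′ (suc-injective (trans (sym (↭-length l↭)) len))))
  where
  l↭ = shift x l₁ l₂
  cover′ : ∀ {i} → i ∈ U → i ∈ l₁ ++ l₂
  cover′ i∈U with ∈-resp-↭ l↭ (cover (there i∈U))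
  ... | here refl = contradiction refl (All.lookup x∉U i∈U)
  ... | there i∈  = i∈

Permutation⇒↭oneTo : ∀ {n l} → Permutation n l → l ↭ oneTo n
Permutation⇒↭oneTo {n} (mkPerm len cover) =
  covering⇒↭ (oneTo-unique n) (λ i∈ → cover (proj₁ (∈-oneTo⁻ n i∈)) (proj₂ (∈-oneTo⁻ n i∈)))
    (trans len (sym (length-oneTo n)))

Permutation⇒Unique : ∀ {n l} → Permutation n l → Unique l
Permutation⇒Unique {n} p =
  Unique-resp-↭ (setoid ℕ) (↭⇒↭ₛ (↭-sym (Permutation⇒↭oneTo p))) (oneTo-unique n)

Permutation⇒bounded : ∀ {n l i} → Permutation n l → i ∈ l → i ≤ n
Permutation⇒bounded {n} p i∈ = proj₂ (∈-oneTo⁻ n (∈-resp-↭ (Permutation⇒↭oneTo p) i∈))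

-- Pattern containment

==⇒≡ : ∀ {x y} → T (x == y) → x ≡ y
==⇒≡ {true}  {true}  _ = refl
==⇒≡ {false} {false} _ = refl

≡⇒== : ∀ {x y} → x ≡ y → T (x == y)
≡⇒== {true}  refl = _
≡⇒== {false} refl = _

∈-subseqs⁺ : ∀ {u w} → u ⊆ w → u ∈ subseqs w
∈-subseqs⁺ []         = here refl
∈-subseqs⁺ (y ∷ʳ u⊆w) = ∈-++⁺ʳ _ (∈-subseqs⁺ u⊆w)
∈-subseqs⁺ (refl ∷ u⊆w) = ∈-++⁺ˡ (∈-map⁺ _ (∈-subseqs⁺ u⊆w))

∈-subseqs⁻ : ∀ {u} w → u ∈ subseqs w → u ⊆ w
∈-subseqs⁻ []      (here refl) = []
∈-subseqs⁻ (x ∷ w) u∈ with ∈-++⁻ (map (x ∷_) (subseqs w)) u∈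
... | inj₂ u∈′ = x ∷ʳ ∈-subseqs⁻ w u∈′
... | inj₁ u∈′ with _ , v∈ , refl ← ∈-map⁻ (x ∷_) u∈′ = refl ∷ ∈-subseqs⁻ w v∈

contains⁺ : ∀ {σ u w} → u ⊆ w → T (orderIsoᵇ u σ) → T (containsᵇ σ w)
contains⁺ u⊆w iso = any⁺ _ (lose (∈-subseqs⁺ u⊆w) iso)

contains⁻ : ∀ {σ} w → T (containsᵇ σ w) → ∃ λ u → u ⊆ w × T (orderIsoᵇ u σ)
contains⁻ w c with u , u∈ , iso ← find (any⁻ _ (subseqs w) c) = u , ∈-subseqs⁻ w u∈ , iso

orderIso⇒length≡ : ∀ u v → T (orderIsoᵇ u v) → length u ≡ length v
orderIso⇒length≡ []      []      _   = refl
orderIso⇒length≡ (x ∷ u) (y ∷ v) iso = cong suc (orderIso⇒length≡ u v (proj₂ (to T-∧ iso)))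

short⇒avoids : ∀ {σ} w → length w < length σ → containsᵇ σ w ≡ false
short⇒avoids {σ} w w<σ with containsᵇ σ w in eq
... | false = refl
... | true with u , u⊆w , iso ← contains⁻ w (from T-≡ eq) =
  contradiction (subst (_≤ length w) (orderIso⇒length≡ u σ iso) (length-mono-≤ u⊆w)) (<⇒≱ w<σ)

⊆-length≡⇒≡ : ∀ {u w : List ℕ} → u ⊆ w → length u ≡ length w → u ≡ w
⊆-length≡⇒≡ []           _  = refl
⊆-length≡⇒≡ (y ∷ʳ u⊆w)   eq = contradiction (length-mono-≤ u⊆w) (<⇒≱ (≤-reflexive (sym eq)))
⊆-length≡⇒≡ (refl ∷ u⊆w) eq = cong (_ ∷_) (⊆-length≡⇒≡ u⊆w (suc-injective eq))

-- A subsequence of full length is the whole word.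
contains⇒orderIso : ∀ {σ} w → length w ≡ length σ → T (containsᵇ σ w) → T (orderIsoᵇ w σ)
contains⇒orderIso {σ} w len c with u , u⊆w , iso ← contains⁻ w c
  with refl ← ⊆-length≡⇒≡ u⊆w (trans (orderIso⇒length≡ u σ iso) (sym len)) = iso

AllPairs-resp-⊆ : ∀ {R : ℕ → ℕ → Set} {L M} → L ⊆ M → AllPairs R M → AllPairs R L
AllPairs-resp-⊆ []           []       = []
AllPairs-resp-⊆ (y ∷ʳ L⊆M)   (_ ∷ r)  = AllPairs-resp-⊆ L⊆M r
AllPairs-resp-⊆ (refl ∷ L⊆M) (px ∷ r) = All-resp-⊆ L⊆M px ∷ AllPairs-resp-⊆ L⊆M r

⊆-++⁻ : ∀ {u} (L M : List ℕ) → u ⊆ L ++ M → ∃ λ u₁ → ∃ λ u₂ → u ≡ u₁ ++ u₂ × u₁ ⊆ L × u₂ ⊆ M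
⊆-++⁻ []      M u⊆ = [] , _ , refl , [] , u⊆
⊆-++⁻ (x ∷ L) M (.x ∷ʳ u⊆) with u₁ , u₂ , eq , u₁⊆ , u₂⊆ ← ⊆-++⁻ L M u⊆ =
  u₁ , u₂ , eq , x ∷ʳ u₁⊆ , u₂⊆
⊆-++⁻ (x ∷ L) M (refl ∷ u⊆) with u₁ , u₂ , eq , u₁⊆ , u₂⊆ ← ⊆-++⁻ L M u⊆ =
  x ∷ u₁ , u₂ , cong (x ∷_) eq , refl ∷ u₁⊆ , u₂⊆

-- The comparison of the head with the rest is a local function of `orderIsoᵇ`; it is exposed as
-- `Pointwise` by removing the second entries one at a time.
orderIso-∷⁻ : ∀ {x y} xs ys → T (orderIsoᵇ (x ∷ xs) (y ∷ ys)) →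
              Pointwise (λ u v → (x <ᵇ u) ≡ (y <ᵇ v)) xs ys × T (orderIsoᵇ xs ys)
orderIso-∷⁻ []       []       _   = [] , _
orderIso-∷⁻ (u ∷ us) (v ∷ vs) iso with p , iso′ ← to T-∧ iso with q , p′ ← to T-∧ p =
  ==⇒≡ q ∷ proj₁ (orderIso-∷⁻ us vs (from T-∧ (p′ , proj₂ (to T-∧ iso′)))) , iso′

orderIso-∷⁺ : ∀ {x y} xs ys → Pointwise (λ u v → (x <ᵇ u) ≡ (y <ᵇ v)) xs ys →
              T (orderIsoᵇ xs ys) → T (orderIsoᵇ (x ∷ xs) (y ∷ ys))
orderIso-∷⁺ []       []       _        _   = _
orderIso-∷⁺ (u ∷ us) (v ∷ vs) (q ∷ qs) iso = from T-∧
  (from T-∧ (≡⇒== q , proj₁ (to T-∧ (orderIso-∷⁺ us vs qs (proj₂ (to T-∧ iso))))) , iso)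

map-Pointwise : ∀ {P : ℕ → ℕ → Set} {g} xs → (∀ {v} → v ∈ xs → P (g v) v) → Pointwise P (map g xs) xs
map-Pointwise []       _ = []
map-Pointwise (x ∷ xs) p = p (here refl) ∷ map-Pointwise xs (p ∘ there)

orderIso-map : ∀ {g} → (∀ u v → (g u <ᵇ g v) ≡ (u <ᵇ v)) → ∀ xs → T (orderIsoᵇ (map g xs) xs)
orderIso-map mono []       = _
orderIso-map mono (x ∷ xs) =
  orderIso-∷⁺ _ xs (map-Pointwise xs λ {v} _ → mono x v) (orderIso-map mono xs)

-- The stack-sorting map

run-[] : ∀ σ st → run σ [] st ≡ st
run-[] σ []       = refl
run-[] σ (y ∷ st) = cong (y ∷_) (run-[] σ st)

run-↭ : ∀ σ xs st → run σ xs st ↭ xs ++ st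
run-↭ σ []       st       = ↭-reflexive (run-[] σ st)
run-↭ σ (x ∷ xs) []       = ↭-trans (run-↭ σ xs (x ∷ [])) (shift x xs [])
run-↭ σ (x ∷ xs) (y ∷ st)
  with containsᵇ σ (x ∷ y ∷ st) | run-↭ σ (x ∷ xs) st | run-↭ σ xs (x ∷ y ∷ st)
... | true  | popped | _      = ↭-trans (prep y popped) (↭-sym (shift y (x ∷ xs) st))
... | false | _      | pushed = ↭-trans pushed (shift x xs (y ∷ st))

run-push : ∀ {σ} x xs st → containsᵇ σ (x ∷ st) ≡ false → run σ (x ∷ xs) st ≡ run σ xs (x ∷ st)
run-push x xs []       _     = refl
run-push x xs (y ∷ st) avoid rewrite avoid = refl

-- While `r` is read, the stack stays shorter than `σ` and so avoids it; every push is allowed and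
-- `r` ends up reversed.
run-pushes : ∀ {σ} r xs st → length r + length st < length σ → run σ (r ++ xs) st ≡ run σ xs (r ʳ++ st)
run-pushes         []      xs st _    = refl
run-pushes {σ} (x ∷ r) xs st r+st<σ = trans
  (run-push x (r ++ xs) st (short⇒avoids (x ∷ st) (≤-<-trans (s≤s (m≤n+m _ (length r))) r+st<σ)))
  (run-pushes r xs (x ∷ st) (subst (_< length σ) (sym (+-suc (length r) (length st))) r+st<σ))

toList-inj : ∀ {n} (xs ys : Vec ℕ n) → toList xs ≡ toList ys → xs ≡ ys
toList-inj xs ys eq = trans (sym (Vec.cast-is-id refl xs)) (toList-injective refl xs ys eq)

-- Runs of the stack as lattice paths.

-- The stack is S ++ B, where B is the part that is never popped before the input is exhausted.
module Trace (σ B : List ℕ) where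

  trace : ∀ {u h} → Vec ℕ u → Vec ℕ h → Path h u
  trace []       S       = end
  trace (x ∷ xs) []      = up (trace xs (x ∷ []))
  trace (x ∷ xs) (y ∷ S) =
    if containsᵇ σ (x ∷ y ∷ toList S ++ B)
    then down (trace (x ∷ xs) S)
    else up (trace xs (x ∷ y ∷ S))

  output : ∀ {u h} → Vec ℕ u → Vec ℕ h → List ℕ
  output []       S       = toList S
  output (x ∷ xs) []      = output xs (x ∷ [])
  output (x ∷ xs) (y ∷ S) =
    if containsᵇ σ (x ∷ y ∷ toList S ++ B)
    then y ∷ output (x ∷ xs) S
    else output xs (x ∷ y ∷ S)

module Run (σ B : List ℕ) (|σ|≡2+|B| : length σ ≡ 2 + length B) where
  open Trace σ B

  -- When `S` is empty, one more push gives a stack of only k - 1 elements, too short to contain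
  -- `σ`; so `B` is not popped while input remains.
  run-output : ∀ {u h} (xs : Vec ℕ u) (S : Vec ℕ h) →
               run σ (toList xs) (toList S ++ B) ≡ output xs S ++ B
  run-output []       S  = run-[] σ _
  run-output (x ∷ xs) [] = trans
    (run-push x (toList xs) B (short⇒avoids (x ∷ B) (≤-reflexive (sym |σ|≡2+|B|))))
    (run-output xs (x ∷ []))
  run-output (x ∷ xs) (y ∷ S)
    with containsᵇ σ (x ∷ y ∷ toList S ++ B) | run-output (x ∷ xs) S | run-output xs (x ∷ y ∷ S)
  ... | true  | popped | _      = cong (y ∷_) popped
  ... | false | _      | pushed = pushed

  length-output : ∀ {u h} (xs : Vec ℕ u) (S : Vec ℕ h) → length (output xs S) ≡ u + h
  length-output []       S  = length-toList S
  length-output {suc u} (x ∷ xs) [] = trans (length-output xs (x ∷ [])) (+-suc u 0)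
  length-output {suc u} {suc h} (x ∷ xs) (y ∷ S)
    with containsᵇ σ (x ∷ y ∷ toList S ++ B) | length-output (x ∷ xs) S | length-output xs (x ∷ y ∷ S)
  ... | true  | popped | _      = cong suc (trans popped (sym (+-suc u h)))
  ... | false | _      | pushed = trans pushed (+-suc u (suc h))

  -- A run can be undone: the path tells each move, a popped element is the head of the output, and
  -- once the input is exhausted the output is the remaining `S`.
  trace-injective : ∀ {u h} (xs xs′ : Vec ℕ u) (S S′ : Vec ℕ h) →
                    trace xs S ≡ trace xs′ S′ → output xs S ≡ output xs′ S′ → xs ≡ xs′ × S ≡ S′
  trace-injective [] [] S S′ _ eq =
    refl , toList-inj S S′ eq
  trace-injective (x ∷ xs) (x′ ∷ xs′) [] [] t eq
    with refl , refl ← trace-injective xs xs′ _ _ (up-injective t) eq = refl , refl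
  trace-injective (x ∷ xs) (x′ ∷ xs′) (y ∷ S) (y′ ∷ S′) t eq
    with containsᵇ σ (x ∷ y ∷ toList S ++ B) | containsᵇ σ (x′ ∷ y′ ∷ toList S′ ++ B)
       | trace-injective (x ∷ xs) (x′ ∷ xs′) S S′ | trace-injective xs xs′ (x ∷ y ∷ S) (x′ ∷ y′ ∷ S′)
  trace-injective (x ∷ xs) (x′ ∷ xs′) (y ∷ S) (y′ ∷ S′) t eq | true | true | popped | _
    with refl , eq′ ← ∷-injective eq
    with refl , refl ← popped (down-injective t) eq′ = refl , refl
  trace-injective (x ∷ xs) (x′ ∷ xs′) (y ∷ S) (y′ ∷ S′) t eq | false | false | _ | pushed
    with refl , refl ← pushed (up-injective t) eq = refl , refl
  trace-injective (x ∷ xs) (x′ ∷ xs′) (y ∷ S) (y′ ∷ S′) () eq | true  | false | _ | _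
  trace-injective (x ∷ xs) (x′ ∷ xs′) (y ∷ S) (y′ ∷ S′) () eq | false | true  | _ | _

  step-pop : ∀ {u h} x (xs : Vec ℕ u) y (S : Vec ℕ h) → containsᵇ σ (x ∷ y ∷ toList S ++ B) ≡ true →
             trace (x ∷ xs) (y ∷ S) ≡ down (trace (x ∷ xs) S) ×
             output (x ∷ xs) (y ∷ S) ≡ y ∷ output (x ∷ xs) S
  step-pop x xs y S contain rewrite contain = refl , refl

  step-push : ∀ {u h} x (xs : Vec ℕ u) y (S : Vec ℕ h) → containsᵇ σ (x ∷ y ∷ toList S ++ B) ≡ false →
              trace (x ∷ xs) (y ∷ S) ≡ up (trace xs (x ∷ y ∷ S)) ×
              output (x ∷ xs) (y ∷ S) ≡ output xs (x ∷ y ∷ S)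
  step-push x xs y S avoid rewrite avoid = refl , refl

  -- Both pops occur with a single element above `B`, where the tested stack has length exactly k
  -- and must itself be an occurrence of `σ`. Hence `x₂` plays first σ(1), then σ(2).
  trace-UDUDU : ∀ {u} (xs : Vec ℕ (3 + u)) {q : Path 1 u} →
                trace xs [] ≡ up (down (up (down (up q)))) →
                ∃ λ x₁ → ∃ λ x₂ → ∃ λ x₃ →
                T (orderIsoᵇ (x₂ ∷ x₁ ∷ B) σ) × T (orderIsoᵇ (x₃ ∷ x₂ ∷ B) σ)
  trace-UDUDU (x₁ ∷ x₂ ∷ x₃ ∷ xs) t
    with containsᵇ σ (x₂ ∷ x₁ ∷ B) in eq₁ | containsᵇ σ (x₃ ∷ x₂ ∷ B) in eq₂
  ... | true | true = x₁ , x₂ , x₃ ,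
    contains⇒orderIso (x₂ ∷ x₁ ∷ B) (sym |σ|≡2+|B|) (from T-≡ eq₁) ,
    contains⇒orderIso (x₃ ∷ x₂ ∷ B) (sym |σ|≡2+|B|) (from T-≡ eq₂)
  trace-UDUDU (x₁ ∷ x₂ ∷ x₃ ∷ xs) () | true  | false
  trace-UDUDU (x₁ ∷ x₂ ∷ x₃ ∷ xs) () | false | true
  trace-UDUDU (x₁ ∷ x₂ ∷ x₃ ∷ xs) () | false | false

  module Realise (R : ℕ → ℕ → Set)
    (forces-pop : ∀ {x y} → R y x → T (orderIsoᵇ (x ∷ y ∷ B) σ))
    (allows-push : ∀ {L} → AllPairs R L → containsᵇ σ (L ++ B) ≡ false) where

    -- The path is run backwards from the output: undoing a push returns the top of the stack to the
    -- input, undoing a pop puts the head of `o` back on the stack. Membership of `xs` and `S` in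
    -- `o` is carried along so that `R` is available for the elements compared.
    realise : ∀ {u h} (p : Path h u) (o : List ℕ) → length o ≡ u + h → AllPairs R o →
              ∃ λ (xs : Vec ℕ u) → ∃ λ (S : Vec ℕ h) →
              All (_∈ o) (toList xs) × toList S ⊆ o × trace xs S ≡ p × output xs S ≡ o
    realise end o refl Ro = [] , fromList o , [] , subst (_⊆ o) (sym o≡) ⊆-refl , refl , o≡
      where o≡ = Vec.toList∘fromList o
    realise {suc u} {zero} (up p) o len Ro
      with xs , x ∷ [] , xs∈ , S⊆ , refl , refl ← realise p o (trans len (sym (+-suc u 0))) Ro =
      x ∷ xs , [] , lookup S⊆ (here refl) ∷ xs∈ , ⊆-trans (x ∷ʳ ⊆-refl) S⊆ , refl , refl
    realise {suc u} {suc h} (up p) o len Ro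
      with realise p o (trans len (sym (+-suc u (suc h)))) Ro
    ... | xs , x ∷ y ∷ S , xs∈ , S⊆ , tr , out =
      x ∷ xs , y ∷ S , lookup S⊆ (here refl) ∷ xs∈ , ⊆-trans (x ∷ʳ ⊆-refl) S⊆ ,
      trans (proj₁ push) (cong up tr) , trans (proj₂ push) out
      where
      -- The stack after the push is a subsequence of `o`, so `R` holds pairwise on it.
      push = step-push x xs y S (allows-push (AllPairs-resp-⊆ S⊆ Ro))
    realise {suc u} {suc h} (down p) (y ∷ o) len (Ry ∷ Ro)
      with realise p o (trans (suc-injective len) (+-suc u h)) Ro
    ... | x ∷ xs , S , x∈ ∷ xs∈ , S⊆ , tr , out =
      x ∷ xs , y ∷ S , All.map there (x∈ ∷ xs∈) , refl ∷ S⊆ ,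
      trans (proj₁ pop) (cong down tr) , trans (proj₂ pop) (cong (y ∷_) out)
      where
      -- The next input `x` lies in `o`, the output still to come after `y`, so `R y x` holds.
      pop = step-pop x xs y S (to T-≡ (contains⁺ {σ} (refl ∷ refl ∷ ++⁺ˡ (toList S) ⊆-refl)
                                                      (forces-pop (All.lookup Ry x∈))))

-- Preimages of a permutation as lattice paths.

++-injective : ∀ (u u′ : List ℕ) {v v′} → length u ≡ length u′ → u ++ v ≡ u′ ++ v′ → u ≡ u′ × v ≡ v′
++-injective []      []        _   eq = refl , eq
++-injective (x ∷ u) (x′ ∷ u′) len eq with refl , eq′ ← ∷-injective eq
  with refl , refl ← ++-injective u u′ (suc-injective len) eq′ = refl , refl

-- `base` holds the k - 2 entries that stay at the bottom of the stack; the entries of `rest`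
-- correspond to the up-steps.
record Split (j m : ℕ) (ρ : List ℕ) : Set where
  constructor mkSplit
  field
    base : Vec ℕ j
    rest : Vec ℕ m
    glue : toList base ++ toList rest ≡ ρ

split : ∀ j m ρ → length ρ ≡ j + m → Split j m ρ
split j m ρ len with r , xs , eq ← Vec.splitAt j (Vec.cast len (fromList ρ)) =
  mkSplit r xs (trans (sym (toList-++ r xs))
    (trans (cong toList (sym eq)) (trans (toList-cast len (fromList ρ)) (toList∘fromList ρ))))

-- Allows the split computed by `split` to be replaced by one known by construction.
Split-irrelevant : ∀ {j m ρ} (p q : Split j m ρ) → p ≡ q
Split-irrelevant (mkSplit r xs refl) (mkSplit r′ xs′ eq)
  with r≡ , xs≡ ← ++-injective (toList r′) (toList r)
         (trans (length-toList r′) (sym (length-toList r))) eq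
  with refl ← toList-inj r′ r r≡ | refl ← toList-inj xs′ xs xs≡ with refl ← eq = refl

module Preimages (σ : List ℕ) (j : ℕ) (|σ|≡2+j : length σ ≡ 2 + j) (m : ℕ) where

  stackBase : Vec ℕ j → List ℕ
  stackBase r = reverse (toList r)

  |σ|≡2+|base| : ∀ r → length σ ≡ 2 + length (stackBase r)
  |σ|≡2+|base| r = trans |σ|≡2+j (cong (2 +_) (sym (trans (length-reverse (toList r)) (length-toList r))))

  open Trace σ

  s-split : ∀ r (xs : Vec ℕ m) → s σ (toList r ++ toList xs) ≡ output (stackBase r) xs [] ++ stackBase r
  s-split r xs = trans
    (run-pushes (toList r) (toList xs) [] (subst₂ _<_
      (sym (trans (+-identityʳ _) (length-toList r))) (sym |σ|≡2+j) (m≤n⇒m≤1+n ≤-refl)))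
    (Run.run-output σ (stackBase r) (|σ|≡2+|base| r) xs [])

  length-out : ∀ r (xs : Vec ℕ m) → length (output (stackBase r) xs []) ≡ m + 0
  length-out r xs = Run.length-output σ (stackBase r) (|σ|≡2+|base| r) xs []

  path : ∀ {ρ} → Split j m ρ → Path 0 m
  path (mkSplit r xs _) = trace (stackBase r) xs []

  -- The common image is cut after m entries: its tail is the reversed base, its head the output of
  -- the run above that base, from which the path recovers the rest.
  path-injective : ∀ {ρ ρ′} (p : Split j m ρ) (p′ : Split j m ρ′) →
                   s σ ρ ≡ s σ ρ′ → path p ≡ path p′ → ρ ≡ ρ′
  path-injective (mkSplit r xs refl) (mkSplit r′ xs′ refl) s≡ path≡
    with out≡ , base≡ ← ++-injective (output (stackBase r) xs []) (output (stackBase r′) xs′ [])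
           (trans (length-out r xs) (sym (length-out r′ xs′)))
           (trans (sym (s-split r xs)) (trans s≡ (s-split r′ xs′)))
    with refl ← toList-inj r r′ (reverse-injective base≡)
    with refl , _ ← Run.trace-injective σ (stackBase r) (|σ|≡2+|base| r) xs xs′ [] [] path≡ out≡ = refl

  module _ (π : List ℕ) where

    splitPreimage : (p : Preimage σ (j + m) π) → Split j m (proj₁ p)
    splitPreimage (ρ , perm , _) = split j m ρ (length≡ (IsPerm⁻ (j + m) ρ perm))

    preimagePath : Preimage σ (j + m) π → Path 0 m
    preimagePath p = path (splitPreimage p)

    preimagePath-injective : Injective _≡_ _≡_ preimagePath
    preimagePath-injective {p@(ρ , perm , eq)} {p′@(ρ′ , perm′ , eq′)} path≡
      -- Once the words agree, the remaining components are proofs of propositions.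
      with refl ← path-injective (splitPreimage p) (splitPreimage p′) (trans eq (sym eq′)) path≡
      with refl ← T-irrelevant perm perm′ | refl ← eq | refl ← eq′ = refl

-- Punching out a missed value would give an injection from `Fin (suc n)` into `Fin n`.
injective-Fin⇒hits : ∀ {n} {f : Fin n → Fin n} → Injective _≡_ _≡_ f → ∀ i → ¬ (∀ j → i ≢ f j)
injective-Fin⇒hits {suc n} {f} inj i misses =
  <⇒notInjective (n<1+n n) (λ {x} {y} eq → inj (punchOut-injective (misses x) (misses y) eq))

Fin-catalan↔Path : ∀ m → Fin (catalan m) ↔ Path 0 m
Fin-catalan↔Path m = subst (λ c → Fin c ↔ Path 0 m) (sym (catalan≡#paths m)) (Fin#paths↔Path 0 m)

-- The non-consecutive case: a path that no preimage realises.

allUp : ∀ h u → Path h u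
allUp h zero    = end
allUp h (suc u) = up (allUp (suc h) u)

<⇒<ᵇ≡true : ∀ {x y} → x < y → (x <ᵇ y) ≡ true
<⇒<ᵇ≡true x<y = to T-≡ (<⇒<ᵇ x<y)

≥⇒<ᵇ≡false : ∀ {x y} → y ≤ x → (x <ᵇ y) ≡ false
≥⇒<ᵇ≡false {x} {y} y≤x with x <ᵇ y in eq
... | false = refl
... | true  = contradiction y≤x (<⇒≱ (<ᵇ⇒< x y (from T-≡ eq)))

true≢false : true ≢ false
true≢false ()

∈-drop₂ : ∀ {v a b : ℕ} {τ} → v ≢ a → v ≢ b → v ∈ a ∷ b ∷ τ → v ∈ τ
∈-drop₂ v≢a v≢b (here refl)         = contradiction refl v≢a
∈-drop₂ v≢a v≢b (there (here refl)) = contradiction refl v≢b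
∈-drop₂ v≢a v≢b (there (there v∈))  = v∈

-- The witness is the successor of the smaller of `a` and `b`. It does not exceed the larger, so it
-- occurs in the permutation, and it equals neither of them.
nonconsecutive⇒separated : ∀ {k a b τ} → Permutation k (a ∷ b ∷ τ) → ¬ Consec (a ∷ b ∷ τ) →
                           ∃ λ c → c ∈ τ × (a <ᵇ c) ≢ (b <ᵇ c)
nonconsecutive⇒separated {k} {a} {b} {τ} perm ¬consec with <-cmp a b
... | tri< a<b _ _ = suc a , ∈-drop₂ 1+n≢n (λ eq → ¬consec (inj₂ (sym eq)))
        (covers perm (s≤s z≤n) (≤-trans a<b (Permutation⇒bounded perm (there (here refl))))) ,
        λ eq → true≢false (trans (sym (<⇒<ᵇ≡true (n<1+n a))) (trans eq (≥⇒<ᵇ≡false a<b)))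
... | tri> _ _ b<a = suc b , ∈-drop₂ (λ eq → ¬consec (inj₁ (sym eq))) 1+n≢n
        (covers perm (s≤s z≤n) (≤-trans b<a (Permutation⇒bounded perm (here refl)))) ,
        λ eq → true≢false (trans (sym (<⇒<ᵇ≡true (n<1+n b))) (trans (sym eq) (≥⇒<ᵇ≡false b<a)))
... | tri≈ _ a≡b _ with (a≢b ∷ _) ∷ _ ← Permutation⇒Unique perm = contradiction a≡b a≢b

pointwise-agree : ∀ {x a b c : ℕ} {B τ} →
  Pointwise (λ u v → (x <ᵇ u) ≡ (a <ᵇ v)) B τ → Pointwise (λ u v → (x <ᵇ u) ≡ (b <ᵇ v)) B τ →
  c ∈ τ → (a <ᵇ c) ≡ (b <ᵇ c)
pointwise-agree (p ∷ _)  (q ∷ _)  (here refl) = trans (sym p) q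
pointwise-agree (_ ∷ ps) (_ ∷ qs) (there c∈)  = pointwise-agree ps qs c∈

-- A bijection followed by `preimagePath` would be an injective self-map of `Fin N`, up to numbering
-- the paths, that misses `missed`. The prefix UDUDU takes three up-steps, which is where n > k
-- enters.
few-preimages : ∀ {j a b τ N} d → Permutation (2 + j) (a ∷ b ∷ τ) → ¬ Consec (a ∷ b ∷ τ) → ∀ π →
                Fin N ↔ Path 0 (3 + d) → ¬ (Fin N ↔ Preimage (a ∷ b ∷ τ) (j + (3 + d)) π)
few-preimages {j} {a} {b} {τ} d perm ¬consec π Fin↔Path Fin↔Preimage =
  injective-Fin⇒hits
    (λ {x} {y} eq → Injection.injective (↔⇒↣ Fin↔Preimage) (preimagePath-injective π (Injection.injective (↔⇒↣ Path↔Fin) eq)))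
    (Inverse.to Path↔Fin missed)
    (λ i eq → missed-path (splitPreimage π (Inverse.to Fin↔Preimage i)) (Injection.injective (↔⇒↣ Path↔Fin) (sym eq)))
  where
  σ = a ∷ b ∷ τ
  Path↔Fin = ↔-sym Fin↔Path
  open Preimages σ j (length≡ perm) (3 + d)
  missed = up (down (up (down (up (allUp 1 d)))))
  missed-path : ∀ {ρ} (p : Split j (3 + d) ρ) → path p ≢ missed
  missed-path (mkSplit r xs _) eq
    with x₁ , x₂ , x₃ , iso₁ , iso₂ ← Run.trace-UDUDU σ (stackBase r) (|σ|≡2+|base| r) xs eq
    with c , c∈τ , a≢b ← nonconsecutive⇒separated perm ¬consec
    with _ ∷ x₂≈a , _ ← orderIso-∷⁻ (x₁ ∷ stackBase r) (b ∷ τ) iso₁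
    with _ , iso₂′ ← orderIso-∷⁻ (x₂ ∷ stackBase r) (b ∷ τ) iso₂
    with x₂≈b , _ ← orderIso-∷⁻ (stackBase r) τ iso₂′ = a≢b (pointwise-agree x₂≈a x₂≈b c∈τ)

-- The consecutive case: a permutation for which every path is realised.

-- Indexing by the smaller value `c` treats both orders of σ(1), σ(2) at once.
data Adjacent (c : ℕ) : ℕ → ℕ → Set where
  ascending  : Adjacent c c (suc c)
  descending : Adjacent c (suc c) c

adjacent-boundsˡ : ∀ {a b c} → Adjacent c a b → c ≤ a × a ≤ suc c
adjacent-boundsˡ ascending  = ≤-refl , n≤1+n _
adjacent-boundsˡ descending = n≤1+n _ , ≤-refl

adjacent-sym : ∀ {a b c} → Adjacent c a b → Adjacent c b a
adjacent-sym ascending  = descending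
adjacent-sym descending = ascending

adjacent-∈⁺ : ∀ {a b c v τ} → Adjacent c a b → v ≢ c → v ≢ suc c → v ∈ a ∷ b ∷ τ → v ∈ τ
adjacent-∈⁺ ascending  v≢c v≢1+c = ∈-drop₂ v≢c v≢1+c
adjacent-∈⁺ descending v≢c v≢1+c = ∈-drop₂ v≢1+c v≢c

adjacent-∉ : ∀ {a b c v τ} → Adjacent c a b → Unique (a ∷ b ∷ τ) → v ∈ τ → v ≢ suc c
adjacent-∉ ascending  (_ ∷ b∉ ∷ _)       v∈ = ≢-sym (All.lookup b∉ v∈)
adjacent-∉ descending ((_ ∷ a∉) ∷ _ ∷ _) v∈ = ≢-sym (All.lookup a∉ v∈)

adjacent-<ᵇ : ∀ {a b c} → Adjacent c a b → (a <ᵇ b) ≢ (b <ᵇ a)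
adjacent-<ᵇ {c = c} ascending  eq =
  true≢false (trans (sym (<⇒<ᵇ≡true (n<1+n c))) (trans eq (≥⇒<ᵇ≡false (n≤1+n c))))
adjacent-<ᵇ {c = c} descending eq =
  true≢false (trans (sym (<⇒<ᵇ≡true (n<1+n c))) (trans (sym eq) (≥⇒<ᵇ≡false (n≤1+n c))))

module Consecutive {j a b c : ℕ} {τ : List ℕ} (perm : Permutation (2 + j) (a ∷ b ∷ τ))
  (adj : Adjacent c a b) (d : ℕ) where

  private
    σ : List ℕ
    σ = a ∷ b ∷ τ

    m : ℕ
    m = 2 + d

    |σ|≡2+j : length σ ≡ 2 + j
    |σ|≡2+j = length≡ perm

  -- Opens a gap in the values of τ, so that {c, c + 1} can be replaced by {c, …, c + m - 1}.
  inflate : ℕ → ℕ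
  inflate v with v ≤? c
  ... | yes _ = v
  ... | no  _ = d + v

  inflate-low : ∀ {v} → v ≤ c → inflate v ≡ v
  inflate-low {v} v≤c with v ≤? c
  ... | yes _   = refl
  ... | no  v≰c = contradiction v≤c v≰c

  inflate-high : ∀ {v} → c < v → inflate v ≡ d + v
  inflate-high {v} c<v with v ≤? c
  ... | yes v≤c = contradiction c<v (≤⇒≯ v≤c)
  ... | no  _   = refl

  inflate-mono : ∀ u v → (inflate u <ᵇ inflate v) ≡ (u <ᵇ v)
  inflate-mono u v with u ≤? c | v ≤? c
  ... | yes _   | yes _   = refl
  ... | yes u≤c | no  v≰c =
    trans (<⇒<ᵇ≡true (≤-trans u<v (m≤n+m v d))) (sym (<⇒<ᵇ≡true u<v))
    where u<v = ≤-<-trans u≤c (≰⇒> v≰c)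
  ... | no  u≰c | yes v≤c =
    trans (≥⇒<ᵇ≡false (≤-trans v≤u (m≤n+m u d))) (sym (≥⇒<ᵇ≡false v≤u))
    where v≤u = ≤-trans v≤c (<⇒≤ (≰⇒> u≰c))
  ... | no  _   | no  _   with u <? v
  ...   | yes u<v = trans (<⇒<ᵇ≡true (+-monoʳ-< d u<v)) (sym (<⇒<ᵇ≡true u<v))
  ...   | no  u≮v = trans (≥⇒<ᵇ≡false (+-monoʳ-≤ d (≮⇒≥ u≮v))) (sym (≥⇒<ᵇ≡false (≮⇒≥ u≮v)))

  Interval : ℕ → Set
  Interval x = c ≤ x × x < c + m

  -- An entry of `τ` is never c + 1, so it is at most c or at least c + 2; inflated, it is at most c
  -- or above the whole interval. Thus any interval element can play σ(1) or σ(2) relative to `B`.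
  interval-inflate : ∀ {x e v} → Interval x → c ≤ e × e ≤ suc c → v ∈ τ → (x <ᵇ inflate v) ≡ (e <ᵇ v)
  interval-inflate {x} {e} {v} (c≤x , x<c+m) (c≤e , e≤1+c) v∈ with v ≤? c
  ... | yes v≤c = trans (≥⇒<ᵇ≡false (≤-trans v≤c c≤x)) (sym (≥⇒<ᵇ≡false (≤-trans v≤c c≤e)))
  ... | no  v≰c = trans (<⇒<ᵇ≡true (<-≤-trans x<c+m c+m≤d+v)) (sym (<⇒<ᵇ≡true (≤-<-trans e≤1+c 1+c<v)))
    where
    1+c<v : suc c < v
    1+c<v = ≤∧≢⇒< (≰⇒> v≰c) (≢-sym (adjacent-∉ adj (Permutation⇒Unique perm) v∈))
    c+m≤d+v : c + m ≤ d + v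
    c+m≤d+v = begin
      c + (2 + d)   ≡⟨ +-assoc c 2 d ⟨
      c + 2 + d     ≡⟨ cong (_+ d) (+-comm c 2) ⟩
      2 + c + d     ≡⟨ +-comm (2 + c) d ⟩
      d + (2 + c)   ≤⟨ +-monoʳ-≤ d 1+c<v ⟩
      d + v         ∎
      where open ≤-Reasoning

  B : List ℕ
  B = map inflate τ

  |σ|≡2+|B| : length σ ≡ 2 + length B
  |σ|≡2+|B| = cong (2 +_) (sym (length-map inflate τ))

  |B|≡j : length B ≡ j
  |B|≡j = suc-injective (suc-injective (trans (sym |σ|≡2+|B|) |σ|≡2+j))

  -- R y x: y may be output before x.
  R : ℕ → ℕ → Set
  R y x = Interval y × Interval x × (x <ᵇ y) ≡ (a <ᵇ b) × (y <ᵇ x) ≡ (b <ᵇ a)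

  forces-pop : ∀ {x y} → R y x → T (orderIsoᵇ (x ∷ y ∷ B) σ)
  forces-pop {x} {y} (y∈ , x∈ , x<ᵇy , _) =
    orderIso-∷⁺ (y ∷ B) (b ∷ τ) (x<ᵇy ∷ map-Pointwise τ (interval-inflate x∈ (adjacent-boundsˡ adj)))
      (orderIso-∷⁺ B τ (map-Pointwise τ (interval-inflate y∈ (adjacent-boundsˡ (adjacent-sym adj))))
        (orderIso-map inflate-mono τ))

  -- B is too short to hold more than k - 2 entries of an occurrence of σ, and on L the
  -- order is opposite to that of the first two entries of σ.
  allows-push : ∀ {L} → AllPairs R L → containsᵇ σ (L ++ B) ≡ false
  allows-push {L} RL with containsᵇ σ (L ++ B) in eq
  ... | false = refl
  ... | true with u , u⊆ , iso ← contains⁻ {σ} (L ++ B) (from T-≡ eq)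
             with u₁ , u₂ , refl , u₁⊆ , u₂⊆ ← ⊆-++⁻ L B u⊆ =
    contradiction iso (no-occurrence u₁ (AllPairs-resp-⊆ u₁⊆ RL) u₂⊆)
    where
    no-occurrence : ∀ u₁ {u₂} → AllPairs R u₁ → u₂ ⊆ B → ¬ T (orderIsoᵇ (u₁ ++ u₂) σ)
    no-occurrence [] {u₂} _ u₂⊆ iso = contradiction
      (subst (_≤ length B) (trans (orderIso⇒length≡ u₂ σ iso) |σ|≡2+|B|) (length-mono-≤ u₂⊆))
      (<⇒≱ (m≤n⇒m≤1+n ≤-refl))
    no-occurrence (x ∷ []) {u₂} _ u₂⊆ iso = contradiction
      (subst (_≤ length B) (suc-injective (trans (orderIso⇒length≡ (x ∷ u₂) σ iso) |σ|≡2+|B|)) (length-mono-≤ u₂⊆))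
      (<⇒≱ ≤-refl)
    no-occurrence (p ∷ q ∷ u₁) {u₂} (((_ , _ , _ , p<ᵇq) ∷ _) ∷ _) _ iso
      with p<ᵇq′ ∷ _ , _ ← orderIso-∷⁻ (q ∷ u₁ ++ u₂) (b ∷ τ) iso = adjacent-<ᵇ adj (trans (sym p<ᵇq′) p<ᵇq)

  -- `o` stands for the interval listed monotonically, against the order of σ(1), σ(2); the
  -- direction is chosen later.
  module _ (o : List ℕ) (|o|≡m : length o ≡ m) (∈o : ∀ {i} → i < m → c + i ∈ o) (Ro : AllPairs R o) where

    π : List ℕ
    π = o ++ B

    π-perm : Permutation (j + m) π
    π-perm = mkPerm (trans (length-++ o) (trans (cong₂ _+_ |o|≡m |B|≡j) (+-comm m j))) cover
      where
      cover : ∀ {i} → 1 ≤ i → i ≤ j + m → i ∈ π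
      -- Values below c come from unshifted entries of `τ`, those in the interval from `o`, and
      -- those from c + m on from entries of `τ` shifted by d.
      cover {i} 1≤i i≤n with i <? c
      ... | yes i<c = ∈-++⁺ʳ o (subst (_∈ B) (inflate-low (<⇒≤ i<c))
              (∈-map⁺ inflate (adjacent-∈⁺ adj (<⇒≢ i<c) (<⇒≢ (m<n⇒m<1+n i<c))
                (covers perm 1≤i (≤-trans (<⇒≤ i<c) (≤-trans (proj₁ (adjacent-boundsˡ adj)) (Permutation⇒bounded perm (here refl))))))))
      ... | no  i≮c with i <? c + m
      ...   | yes i<c+m = ∈-++⁺ˡ (subst (_∈ o) (m+[n∸m]≡n c≤i)
                (∈o (+-cancelˡ-< c _ _ (subst (_< c + m) (sym (m+[n∸m]≡n c≤i)) i<c+m))))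
        where c≤i = ≮⇒≥ i≮c
      ...   | no  i≮c+m = ∈-++⁺ʳ o (subst (_∈ B) (trans (inflate-high c<v) d+v≡i)
                (∈-map⁺ inflate (adjacent-∈⁺ adj (>⇒≢ c<v) (>⇒≢ 2+c≤v)
                  (covers perm (≤-trans (s≤s z≤n) 2+c≤v) v≤k))))
        where
        open ≤-Reasoning
        v = i ∸ d
        d+[2+c]≤i : d + (2 + c) ≤ i
        d+[2+c]≤i = begin
          d + (2 + c)   ≡⟨ +-comm d (2 + c) ⟩
          2 + c + d     ≡⟨ cong (_+ d) (+-comm 2 c) ⟩
          c + 2 + d     ≡⟨ +-assoc c 2 d ⟩
          c + m         ≤⟨ ≮⇒≥ i≮c+m ⟩
          i             ∎
        d+v≡i : d + v ≡ i
        d+v≡i = m+[n∸m]≡n (≤-trans (m≤m+n d (2 + c)) d+[2+c]≤i)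
        2+c≤v : 2 + c ≤ v
        2+c≤v = +-cancelˡ-≤ d _ _ (subst (d + (2 + c) ≤_) (sym d+v≡i) d+[2+c]≤i)
        c<v : c < v
        c<v = ≤-trans (n≤1+n (suc c)) 2+c≤v
        v≤k : v ≤ 2 + j
        v≤k = +-cancelˡ-≤ d _ _ (begin
          d + v         ≡⟨ d+v≡i ⟩
          i             ≤⟨ i≤n ⟩
          j + (2 + d)   ≡⟨ +-assoc j 2 d ⟨
          j + 2 + d     ≡⟨ +-comm (j + 2) d ⟩
          d + (j + 2)   ≡⟨ cong (d +_) (+-comm j 2) ⟩
          d + (2 + j)   ∎)

    open Preimages σ j |σ|≡2+j m

    |reverse-B|≡j : length (reverse B) ≡ j
    |reverse-B|≡j = trans (length-reverse B) |B|≡j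

    -- Reversed, because pushing these entries reverses them again and leaves `B` on the stack.
    r : Vec ℕ j
    r = Vec.cast |reverse-B|≡j (fromList (reverse B))

    stackBase-r : stackBase r ≡ B
    stackBase-r = trans
      (cong reverse (trans (toList-cast |reverse-B|≡j (fromList (reverse B))) (toList∘fromList (reverse B))))
      (reverse-involutive B)

    preimagePath-surjective : ∀ p → ∃ λ ρ → preimagePath π ρ ≡ p
    preimagePath-surjective p
      with xs , [] , _ , _ , tr , out ← Run.Realise.realise σ B |σ|≡2+|B| R forces-pop allows-push p o
             (trans |o|≡m (sym (+-identityʳ m))) Ro =
      (ρ , ρ-perm , s≡π) ,
      trans (cong path (Split-irrelevant (splitPreimage π (ρ , ρ-perm , s≡π)) (mkSplit r xs refl)))
            (trans (cong (λ B′ → Trace.trace σ B′ xs []) stackBase-r) tr)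
      where
      ρ = toList r ++ toList xs
      s≡π : s σ ρ ≡ π
      s≡π = trans (s-split r xs) (trans (cong (λ B′ → Trace.output σ B′ xs [] ++ B′) stackBase-r) (cong (_++ B) out))
      -- The image is a rearrangement of the input, so `ρ` inherits being a permutation from `π`.
      ρ-perm : IsPerm (j + m) ρ
      ρ-perm = IsPerm⁺ (Permutation-resp-↭ (subst₂ _↭_ s≡π (++-identityʳ ρ) (run-↭ σ ρ [])) π-perm)

    Fin↔Preimage : Fin (catalan m) ↔ Preimage σ (j + m) π
    Fin↔Preimage = ↔-sym (⤖⇒↔ (mk⤖ (preimagePath-injective π , surj))) ↔-∘ Fin-catalan↔Path m
      where
      surj : ∀ p → ∃ λ ρ → ∀ {z} → z ≡ ρ → preimagePath π z ≡ p
      surj p with ρ , eq ← preimagePath-surjective p = ρ , λ { refl → eq }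

many-preimages : ∀ {j a b τ} d → Permutation (2 + j) (a ∷ b ∷ τ) → Consec (a ∷ b ∷ τ) →
  Σ (List ℕ) (λ π → IsPerm (j + (2 + d)) π × (Fin (catalan (2 + d)) ↔ Preimage (a ∷ b ∷ τ) (j + (2 + d)) π))
many-preimages {b = c} d perm (inj₁ refl) = π o len cov Ro , IsPerm⁺ (π-perm o len cov Ro) , Fin↔Preimage o len cov Ro
  where
  open Consecutive {c = c} perm descending d
  -- Increasing, since here σ(1) > σ(2).
  o = applyUpTo (c +_) (2 + d)
  len = length-applyUpTo (c +_) (2 + d)
  cov = ∈-applyUpTo⁺ (c +_)
  Ro : AllPairs R o
  Ro = applyUpTo⁺₁ (c +_) (2 + d) λ {i} {i′} i<i′ i′<m →
    (m≤m+n c i , +-monoʳ-< c (<-trans i<i′ i′<m)) , (m≤m+n c i′ , +-monoʳ-< c i′<m) ,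
    trans (≥⇒<ᵇ≡false (+-monoʳ-≤ c (<⇒≤ i<i′))) (sym (≥⇒<ᵇ≡false (n≤1+n c))) ,
    trans (<⇒<ᵇ≡true (+-monoʳ-< c i<i′)) (sym (<⇒<ᵇ≡true (n<1+n c)))
many-preimages {a = c} d perm (inj₂ refl) = π o len cov Ro , IsPerm⁺ (π-perm o len cov Ro) , Fin↔Preimage o len cov Ro
  where
  open Consecutive {c = c} perm ascending d
  -- Decreasing, since here σ(1) < σ(2).
  o = applyDownFrom (c +_) (2 + d)
  len = length-applyDownFrom (c +_) (2 + d)
  cov = ∈-applyDownFrom⁺ (c +_)
  Ro : AllPairs R o
  Ro = applyDownFrom⁺₁ (c +_) (2 + d) λ {i} {i′} i′<i i<m →
    (m≤m+n c i , +-monoʳ-< c i<m) , (m≤m+n c i′ , +-monoʳ-< c (<-trans i′<i i<m)) ,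
    trans (<⇒<ᵇ≡true (+-monoʳ-< c i′<i)) (sym (<⇒<ᵇ≡true (n<1+n c))) ,
    trans (≥⇒<ᵇ≡false (+-monoʳ-≤ c (<⇒≤ i′<i))) (sym (≥⇒<ᵇ≡false (n≤1+n c)))

-- Both cases restated in terms of n and k.

theorem3p2 : (k : ℕ) → (σ : List ℕ) → 2 ≤ k → IsPerm k σ →
    (Consec σ → (n : ℕ) → k ≤ n →
    Σ (List ℕ) (λ π → IsPerm n π × (Fin (catalan (n ∸ k + 2)) ↔ Preimage σ n π)))
    × (¬ Consec σ → (n : ℕ) → k < n → (π : List ℕ) → IsPerm n π →
    ¬ (Fin (catalan (n ∸ k + 2)) ↔ Preimage σ n π))
theorem3p2 (suc zero)      _        (s≤s ()) _
theorem3p2 (suc (suc j))   []       _        ()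
theorem3p2 (suc (suc j))   (a ∷ []) _        ()
theorem3p2 k@(suc (suc j)) σ@(a ∷ b ∷ τ) _ isPerm = consecutive , nonconsecutive
  where
  perm = IsPerm⁻ k σ isPerm

  k+d≡j+[2+d] : ∀ d → k + d ≡ j + (2 + d)
  k+d≡j+[2+d] d = trans (cong (_+ d) (+-comm 2 j)) (+-assoc j 2 d)

  consecutive : Consec σ → (n : ℕ) → k ≤ n →
    Σ (List ℕ) (λ π → IsPerm n π × (Fin (catalan (n ∸ k + 2)) ↔ Preimage σ n π))
  consecutive consec n k≤n =
    subst₂ (λ n m → Σ (List ℕ) (λ π → IsPerm n π × (Fin (catalan m) ↔ Preimage σ n π)))
      (trans (sym (k+d≡j+[2+d] (n ∸ k))) (m+[n∸m]≡n k≤n)) (+-comm 2 (n ∸ k))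
      (many-preimages (n ∸ k) perm consec)

  nonconsecutive : ¬ Consec σ → (n : ℕ) → k < n → (π : List ℕ) → IsPerm n π →
    ¬ (Fin (catalan (n ∸ k + 2)) ↔ Preimage σ n π)
  nonconsecutive ¬consec n k<n π _ =
    subst₂ (λ n m → ¬ (Fin (catalan m) ↔ Preimage σ n π))
      (trans (sym (k+d≡j+[2+d] (suc d))) (trans (cong (k +_) 1+d≡n∸k) (m+[n∸m]≡n (<⇒≤ k<n))))
      (trans (+-comm 2 (suc d)) (cong (_+ 2) 1+d≡n∸k))
      (few-preimages d perm ¬consec π (Fin-catalan↔Path (3 + d)))
    where
    -- As n > k, this gives n - k + 2 = 3 + d, leaving room for the three up-steps.
    d = n ∸ suc k
    1+d≡n∸k : suc d ≡ n ∸ k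
    1+d≡n∸k = sym (+-∸-assoc 1 k<n)
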